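{- Let $L$ be a finite label set and let $\varphi,\psi$ be positive existential HML formulas. For every pointed finite $L$-labeled transition system $(G,v)$, the following are equivalent: (i) for every finite $L$-labeled transition system $H$ and every homomorphism $h:G\to H$, if $\varphi$ holds at $h(v)$ in $H$ then $\psi$ holds at $h(v)$ in $H$ (i.e. $(S_\varphi\to_\Omega S_\psi)(G,v)$); (ii) $\psi$ holds at $\iota(v)$ in $\mathrm{Ext}(G,v,\varphi)$.
   Context: Positive existential HML ($\mathit{HML}^+$) is generated by $\top$, $\varphi_1\wedge\varphi_2$, and $\langle a\rangle\varphi$ ($a\in L$), with $\langle a\rangle\varphi$ true at $s$ iff some $a$-successor satisfies $\varphi$. Homomorphisms are maps on states preserving labeled edges. $S_\varphi$ is the subfunctor of the underlying-set presheaf with $S_\varphi(G,v)$ iff $\varphi$ holds at $v$ in $G$, and the presheaf Heyting implication is $(S_1\to_\Omega S_2)(G,v)$ iff for all $H$ and $h:G\to H$, $S_1(H,h(v))\Rightarrow S_2(H,h(v))$. The free extension $\mathrm{Ext}(G,v,\varphi)$ with inclusion $\iota:G\hookrightarrow\mathrm{Ext}(G,v,\varphi)$ is defined recursively: for $\top$, $G$ itself; for $\varphi_1\wedge\varphi_2$, adjoin (disjointly) the witness trees for $\varphi_1$ and for $\varphi_2$ at $v$; for $\langle a\rangle\varphi'$, adjoin a fresh vertex $w$ with an edge $v\xrightarrow{a}w$ and then the witness tree for $\varphi'$ at $w$; all original edges of $G$ are kept, and no other edges are added. -}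

module Defs where

open import Level using (Level; 0ℓ; _⊔_) renaming (suc to lsuc)
open import Data.Nat.Base using (suc)
open import Data.Fin.Base using (Fin; zero; suc)
open import Data.Fin.Properties using (inj⇒≟)
open import Data.Maybe.Base using (Maybe; just; nothing)
open import Data.Product.Base using (∃; _×_; _,_)
open import Data.Unit.Base using (⊤; tt)
open import Function.Base using (id; _∘_)
open import Function.Bundles using (_↔_; Inverse; mk↔ₛ′)
open import Function.Properties.Inverse using (↔⇒↣)
open import Relation.Binary.Definitions using (DecidableEquality)
open import Relation.Binary.PropositionalEquality using (_≡_; refl; cong)
open import Relation.Nullary.Decidable using (Dec; yes; no; map′; _×-dec_)

private
  variable
    ℓ₁ ℓ₂ : Level
    L : Set

Finite : Set → Set
Finite A = ∃ λ n → A ↔ Fin n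

Finite⇒≟ : {A : Set} → Finite A → DecidableEquality A
Finite⇒≟ (_ , A↔Fin) = inj⇒≟ (↔⇒↣ A↔Fin)

Finite-Maybe : {A : Set} → Finite A → Finite (Maybe A)
Finite-Maybe {A} (n , A↔Fin) = suc n , mk↔ₛ′ to′ from′ to′∘from′ from′∘to′
  where
  open Inverse A↔Fin
  to′ : Maybe A → Fin (suc n)
  to′ nothing  = zero
  to′ (just x) = suc (to x)
  from′ : Fin (suc n) → Maybe A
  from′ zero    = nothing
  from′ (suc i) = just (from i)
  to′∘from′ : ∀ i → to′ (from′ i) ≡ i
  to′∘from′ zero    = refl
  to′∘from′ (suc i) = cong suc (strictlyInverseˡ i)
  from′∘to′ : ∀ x → from′ (to′ x) ≡ x
  from′∘to′ nothing  = refl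
  from′∘to′ (just x) = cong just (strictlyInverseʳ x)

-- Edges form a relation (at most one a-edge from s to t, for each a, s, t):
-- only whether `Edge s a t` is inhabited matters, and that is decidable,
-- as it is for any finite system given as a table.
record FinLTS (L : Set) : Set₁ where
  field
    State  : Set
    Edge   : State → L → State → Set
    finite : Finite State
    edge?  : ∀ s a t → Dec (Edge s a t)

open FinLTS public

record Hom (G H : FinLTS L) : Set where
  field
    map       : State G → State H
    preserves : ∀ {s a t} → Edge G s a t → Edge H (map s) a (map t)

open Hom public

idHom : {G : FinLTS L} → Hom G G
idHom .map       = id
idHom .preserves = id

infixr 9 _∘ₕ_

_∘ₕ_ : {G H K : FinLTS L} → Hom H K → Hom G H → Hom G K
(k ∘ₕ h) .map       = map k ∘ map h
(k ∘ₕ h) .preserves = preserves k ∘ preserves h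

infixr 6 _∧′_
infixr 7 ⟨_⟩_

data HML⁺ (L : Set) : Set where
  ⊤′   : HML⁺ L
  _∧′_ : HML⁺ L → HML⁺ L → HML⁺ L
  ⟨_⟩_ : L → HML⁺ L → HML⁺ L

Sat : (G : FinLTS L) → State G → HML⁺ L → Set
Sat G s ⊤′        = ⊤
Sat G s (φ ∧′ ψ)  = Sat G s φ × Sat G s ψ
Sat G s (⟨ a ⟩ φ) = ∃ λ t → Edge G s a t × Sat G t φ

Sat-preserved : {G H : FinLTS L} (h : Hom G H) (φ : HML⁺ L) {s : State G} →
                Sat G s φ → Sat H (map h s) φ
Sat-preserved h ⊤′        _           = tt
Sat-preserved h (φ ∧′ ψ)  (p , q)     = Sat-preserved h φ p , Sat-preserved h ψ q
Sat-preserved h (⟨ a ⟩ φ) (t , e , p) = map h t , preserves h e , Sat-preserved h φ p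

-- Subfunctors of the underlying-set presheaf G ↦ State G, which acts
-- covariantly on homomorphisms.
record Subfunctor (L : Set) (ℓ : Level) : Set (lsuc 0ℓ ⊔ lsuc ℓ) where
  field
    holds  : (G : FinLTS L) → State G → Set ℓ
    stable : {G H : FinLTS L} (h : Hom G H) {v : State G} →
             holds G v → holds H (map h v)

open Subfunctor public

S : HML⁺ L → Subfunctor L 0ℓ
S φ .holds G v = Sat G v φ
S φ .stable h  = Sat-preserved h φ

infixr 5 _→Ω_

_→Ω_ : Subfunctor L ℓ₁ → Subfunctor L ℓ₂ → Subfunctor L (lsuc 0ℓ ⊔ ℓ₁ ⊔ ℓ₂)
_→Ω_ {L = L} S₁ S₂ .holds G v =
  (H : FinLTS L) (h : Hom G H) → holds S₁ H (map h v) → holds S₂ H (map h v)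
(S₁ →Ω S₂) .stable h f K k = f K (k ∘ₕ h)

-- The fresh vertex is `nothing`.
data AddEdge (G : FinLTS L) (v : State G) (a : L) :
             Maybe (State G) → L → Maybe (State G) → Set where
  old : ∀ {s b t} → Edge G s b t → AddEdge G v a (just s) b (just t)
  new : AddEdge G v a (just v) a nothing

module _ {L : Set} (L-finite : Finite L) where

  addSuccessor : (G : FinLTS L) → State G → L → FinLTS L
  addSuccessor G v a .State  = Maybe (State G)
  addSuccessor G v a .Edge   = AddEdge G v a
  addSuccessor G v a .finite = Finite-Maybe (finite G)
  addSuccessor G v a .edge? nothing  b _        = no λ ()
  addSuccessor G v a .edge? (just s) b (just t) =
    map′ old (λ { (old e) → e }) (edge? G s b t)
  addSuccessor G v a .edge? (just s) b nothing  =
    map′ (λ { (refl , refl) → new }) (λ { new → refl , refl })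
         (Finite⇒≟ (finite G) s v ×-dec Finite⇒≟ L-finite b a)

  addSuccessor-incl : (G : FinLTS L) (v : State G) (a : L) →
                      Hom G (addSuccessor G v a)
  addSuccessor-incl G v a .map       = just
  addSuccessor-incl G v a .preserves = old

  -- Ext G v φ is G with the witness tree of φ grafted at v.  For φ ∧′ ψ the
  -- tree of ψ is grafted at v after that of φ; every grafted vertex is fresh,
  -- so the two trees are disjoint and share only the vertex v.
  Ext : (G : FinLTS L) → State G → HML⁺ L → FinLTS L
  ι   : (G : FinLTS L) (v : State G) (φ : HML⁺ L) → Hom G (Ext G v φ)

  Ext G v ⊤′        = G
  Ext G v (φ ∧′ ψ)  = Ext (Ext G v φ) (map (ι G v φ) v) ψ
  Ext G v (⟨ a ⟩ φ) = Ext (addSuccessor G v a) nothing φ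

  ι G v ⊤′        = idHom
  ι G v (φ ∧′ ψ)  = ι (Ext G v φ) (map (ι G v φ) v) ψ ∘ₕ ι G v φ
  ι G v (⟨ a ⟩ φ) = ι (addSuccessor G v a) nothing φ ∘ₕ addSuccessor-incl G v a

{-# OPTIONS --safe #-}
-- Ext G v φ is the weakly initial extension of G along which φ becomes true at
-- v: φ holds there, and every homomorphism out of G making φ true at v factors
-- through ι.  So ι is the universal test case for (i).
module Submission where

open import Defs
open import Data.Maybe.Base using (maybe′; nothing)
open import Data.Product.Base using (∃; _,_)
open import Data.Unit.Base using (tt)
open import Function.Bundles using (_⇔_; mk⇔)
open import Relation.Binary.PropositionalEquality
  using (_≡_; refl; sym; trans; subst)

module _ {L : Set} (L-finite : Finite L) where

  Ext-sat : (G : FinLTS L) (v : State G) (φ : HML⁺ L) →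
            Sat (Ext L-finite G v φ) (map (ι L-finite G v φ) v) φ
  Ext-sat G v ⊤′        = tt
  Ext-sat G v (φ ∧′ ψ)  =
    -- `φ` became true before the tree of `ψ` was grafted; positive formulas survive the later
    -- inclusion.
    Sat-preserved (ι L-finite (Ext L-finite G v φ) _ ψ) φ (Ext-sat G v φ) ,
    Ext-sat (Ext L-finite G v φ) _ ψ
  Ext-sat G v (⟨ a ⟩ φ) =
    _ , preserves (ι L-finite (addSuccessor L-finite G v a) nothing φ) new ,
    Ext-sat (addSuccessor L-finite G v a) nothing φ

  -- The only edge at the fresh vertex is `new`, so any `a`-successor `t` of the image of `v` can
  -- serve as its image.
  addSuccessor-lift : {G H : FinLTS L} {v : State G} {a : L} (h : Hom G H)
                      {t : State H} → Edge H (map h v) a t →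
                      Hom (addSuccessor L-finite G v a) H
  addSuccessor-lift h {t} e .map               = maybe′ (map h) t
  addSuccessor-lift h     e .preserves (old d) = preserves h d
  addSuccessor-lift h     e .preserves new     = e

  -- The proof of `Sat` names a witness for each diamond, and the grafted vertices are sent to these
  -- witnesses.
  Ext-lift : (G : FinLTS L) (v : State G) (φ : HML⁺ L)
             {H : FinLTS L} (h : Hom G H) → Sat H (map h v) φ →
             ∃ λ (k : Hom (Ext L-finite G v φ) H) →
               ∀ s → map k (map (ι L-finite G v φ) s) ≡ map h s
  Ext-lift G v ⊤′        h _           = h , λ _ → refl
  Ext-lift G v (φ ∧′ ψ)  {H} h (p , q) =
    let k , k∘ι≡h = Ext-lift G v φ h p
        l , l∘ι≡k = Ext-lift (Ext L-finite G v φ) _ ψ k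
                      -- The second graft sits at the image of `v` in the first extension, which `k`
                      -- sends to `map h v` only propositionally.
                      (subst (λ s → Sat H s ψ) (sym (k∘ι≡h v)) q)
    in l , λ s → trans (l∘ι≡k _) (k∘ι≡h s)
  Ext-lift G v (⟨ a ⟩ φ) h (t , e , p) =
    let k , k∘ι≡h = Ext-lift (addSuccessor L-finite G v a) nothing φ
                      (addSuccessor-lift h e) p
    -- Taken at `just s`, where the lifted map computes to `map h s`.
    in k , λ s → k∘ι≡h _

mainTheorem19 : {L : Set} (L-finite : Finite L) (φ ψ : HML⁺ L) (G : FinLTS L) (v : State G) →
    holds (S φ →Ω S ψ) G v
    ⇔ Sat (Ext L-finite G v φ) (map (ι L-finite G v φ) v) ψ
mainTheorem19 L-finite φ ψ G v = mk⇔
  (λ f → f (Ext L-finite G v φ) (ι L-finite G v φ) (Ext-sat L-finite G v φ))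
  λ p H h q →
    let k , k∘ι≡h = Ext-lift L-finite G v φ h q
    -- `ψ` is positive, so its truth in the extension is pushed forward along `k`.
    in subst (λ s → Sat H s ψ) (k∘ι≡h v) (Sat-preserved k ψ p)
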